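{- The only bipartite planar squco graph is $K_1$. That is, if $G$ is a finite simple graph that is bipartite, planar, and satisfies $G^2 \cong \overline{G}$, then $G$ has exactly one vertex.
   Context: All graphs are finite and simple. The square $G^2$ of a graph $G$ has vertex set $V(G)$, and two distinct vertices are adjacent in $G^2$ if and only if their distance in $G$ is at most $2$. A graph $G$ is square-complementary (squco) if $G^2$ is isomorphic to the complement $\overline{G}$ of $G$. $K_1$ denotes the graph with one vertex. -}

module Defs where

open import Data.Bool using (Bool; true; false; _∧_; _∨_; not; if_then_else_)
open import Data.Nat using (ℕ; zero; suc; _+_; _*_; _≤ᵇ_; _≡ᵇ_)
open import Data.Fin using (Fin; toℕ) renaming (zero to fz; suc to fs)
open import Data.Fin.Properties using (_≟_)
open import Data.Product using (Σ; _×_; _,_; ∃-syntax)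
open import Relation.Nullary.Decidable using (⌊_⌋)
open import Relation.Binary.PropositionalEquality using (_≡_; _≢_)
open import Function.Bundles using (_⤖_; Bijection)

record Graph (n : ℕ) : Set where
  field
    adj   : Fin n → Fin n → Bool
    sym   : ∀ u v → adj u v ≡ adj v u
    irrfl : ∀ v → adj v v ≡ false
open Graph public

anyFin : ∀ {n} → (Fin n → Bool) → Bool
anyFin {zero}  f = false
anyFin {suc n} f = f fz ∨ anyFin (λ i → f (fs i))

allFin : ∀ {n} → (Fin n → Bool) → Bool
allFin {zero}  f = true
allFin {suc n} f = f fz ∧ allFin (λ i → f (fs i))

count : ∀ {n} → (Fin n → Bool) → ℕ
count {zero}  f = 0
count {suc n} f = (if f fz then 1 else 0) + count (λ i → f (fs i))

allBelow : ℕ → (ℕ → Bool) → Bool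
allBelow zero    p = true
allBelow (suc b) p = allBelow b p ∧ p b

iter : ∀ {A : Set} → ℕ → (A → A) → A → A
iter zero    f x = x
iter (suc k) f x = f (iter k f x)

eqF : ∀ {n} → Fin n → Fin n → Bool
eqF u v = ⌊ u ≟ v ⌋

sqAdj : ∀ {n} → Graph n → Fin n → Fin n → Bool
sqAdj G u v = not (eqF u v) ∧ (adj G u v ∨ anyFin (λ w → adj G u w ∧ adj G w v))

complAdj : ∀ {n} → Graph n → Fin n → Fin n → Bool
complAdj G u v = not (eqF u v) ∧ not (adj G u v)

Isomorphic : ∀ {n} → (Fin n → Fin n → Bool) → (Fin n → Fin n → Bool) → Set
Isomorphic {n} A B =
  Σ (Fin n ⤖ Fin n) λ σ → (∀ u v → A u v ≡ B (Bijection.to σ u) (Bijection.to σ v))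

Squco : ∀ {n} → Graph n → Set
Squco G = Isomorphic (sqAdj G) (complAdj G)

Bipartite : ∀ {n} → Graph n → Set
Bipartite {n} G = Σ (Fin n → Bool) λ χ → (∀ u v → adj G u v ≡ true → χ u ≢ χ v)

-- Planarity, via combinatorial embeddings (rotation systems) of genus 0.
--
-- A rotation system assigns to each vertex u a cyclic permutation
-- ρ u of its neighbourhood N(u).  Darts are ordered pairs (u , v)
-- with u ~ v.  The face permutation is φ (u , v) = (v , ρ v u); faces
-- are the φ-orbits on darts.  The embedding has genus 0 on every
-- component iff  n − m + f + i = 2c,  where m = #edges, f = #faces,
-- i = #isolated vertices, c = #connected components.  Since #darts = 2m
-- this is written  2n + 2f + 2i ≡ 4c + #darts.

record RotationSystem {n : ℕ} (G : Graph n) : Set where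
  field
    ρ      : Fin n → Fin n → Fin n
    closed : ∀ u v → adj G u v ≡ true → adj G u (ρ u v) ≡ true
    inj    : ∀ u v w → adj G u v ≡ true → adj G u w ≡ true → ρ u v ≡ ρ u w → v ≡ w
    cyclic : ∀ u v w → adj G u v ≡ true → adj G u w ≡ true →
             ∃[ k ] (iter k (ρ u) v ≡ w)
open RotationSystem public

faceStep : ∀ {n} {G : Graph n} → RotationSystem G → Fin n × Fin n → Fin n × Fin n
faceStep R (u , v) = (v , ρ R v u)

lexLeq : ∀ {n} → Fin n × Fin n → Fin n × Fin n → Bool
lexLeq (a , b) (c , d) =
  (not (toℕ a ≡ᵇ toℕ c) ∧ (toℕ a ≤ᵇ toℕ c)) ∨ ((toℕ a ≡ᵇ toℕ c) ∧ (toℕ b ≤ᵇ toℕ d))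

-- a dart is the lexicographically least element of its face orbit
-- (orbits have length < n*n, so checking k < n*n covers the orbit)
orbitMin : ∀ {n} {G : Graph n} → RotationSystem G → Fin n × Fin n → Bool
orbitMin {n} R d = allBelow (n * n) (λ k → lexLeq d (iter k (faceStep R) d))

count2 : ∀ {n} → (Fin n → Fin n → Bool) → ℕ
count2 f = sumFin (λ u → count (f u))
  where
  sumFin : ∀ {m} → (Fin m → ℕ) → ℕ
  sumFin {zero}  g = 0
  sumFin {suc m} g = g fz + sumFin (λ i → g (fs i))

numDarts : ∀ {n} → Graph n → ℕ
numDarts G = count2 (adj G)

numFaces : ∀ {n} {G : Graph n} → RotationSystem G → ℕ
numFaces {G = G} R = count2 (λ u v → adj G u v ∧ orbitMin R (u , v))

numIsolated : ∀ {n} → Graph n → ℕ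
numIsolated G = count (λ v → not (anyFin (adj G v)))

reach : ∀ {n} → Graph n → ℕ → Fin n → Fin n → Bool
reach G zero    u v = eqF u v
reach G (suc k) u v = reach G k u v ∨ anyFin (λ w → reach G k u w ∧ adj G w v)

-- u and v lie in the same connected component (paths need < n edges)
connected : ∀ {n} → Graph n → Fin n → Fin n → Bool
connected {n} G u v = reach G n u v

numComponents : ∀ {n} → Graph n → ℕ
numComponents G = count (λ v → allFin (λ u → not (connected G v u) ∨ (toℕ v ≤ᵇ toℕ u)))

Planar : ∀ {n} → Graph n → Set
Planar {n} G = Σ (RotationSystem G) λ R →
  2 * n + 2 * numFaces R + 2 * numIsolated G ≡ 4 * numComponents G + numDarts G

{-# OPTIONS --safe #-}

-- Let F be the complement of the square of G, so that σ : F ≅ G.  A 2-colouring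
-- χ of G induces the 2-colouring χ ∘ σ of F, and comparing the two shows that no
-- two vertices of the same colour are adjacent in F.  Hence F is the bipartite
-- complement of G, and in both graphs any two vertices of the same colour have a
-- common neighbour.  It follows that every vertex has at least three neighbours
-- and three non-neighbours in the opposite side, so the sides have sizes a, b ≥ 6,
-- while |E(G)| = ab/2.  Euler's formula gives ab/2 ≤ 2(a + b) - 4, so one side,
-- say A, has size 6 and all vertices of the other side B are cubic.  Now each of the
-- 15 pairs in A occurs as a corner at some y ∈ B.  There are |E(G)| such corners,
-- and every face has at least three of them, except that a 4-face has two, with the
-- same pair.  If there are q 4-faces, then 3|faces| ≤ |E(G)| + q, and dropping one
-- corner from each 4-face loses no pair, so q + 15 ≤ |E(G)|.  The resulting bound
-- 3|faces| + 15 ≤ 2|E(G)| contradicts Euler's formula.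

module Submission where

open import Defs hiding (sym)
open import Data.Bool as Bool using (Bool; true; false; not; T; _∧_; _∨_; if_then_else_)
open import Data.Bool.Properties
  using (¬-not; not-¬; not-involutive; ∧-conicalˡ; ∧-conicalʳ; ∧-zeroʳ; ∨-conicalˡ; ∨-conicalʳ; ∨-identityʳ; ∨-zeroʳ)
open import Data.Empty using (⊥; ⊥-elim)
open import Data.Fin as Fin using (Fin; toℕ; combine) renaming (zero to fz; suc to fs)
open import Data.Fin.Properties as Fin using (toℕ-injective; toℕ<n; combine-injective; pigeonhole; injective⇒≤)
open import Data.List as List using (List; []; _∷_; _++_; map; filter; length; lookup; tabulate; cartesianProduct)
open import Data.List.Membership.Propositional using (_∈_)
open import Data.List.Membership.Propositional.Properties
open import Data.List.Properties using (length-map; length-++; length-tabulate; filter-++; map-tabulate; tabulate-cong)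
open import Data.List.Relation.Unary.All as All using (All; []; _∷_)
open import Data.List.Relation.Unary.AllPairs using ([]; _∷_)
open import Data.List.Relation.Unary.Any using (here; there; index)
open import Data.List.Relation.Unary.Any.Properties using (lookup-index)
open import Data.List.Relation.Unary.Unique.Propositional using (Unique)
import Data.List.Relation.Unary.Unique.Propositional.Properties as Unique
open import Data.Nat using (ℕ; zero; suc; _+_; _*_; _∸_; _/_; _%_; _≤_; _<_; _≤?_; _<?_; _≡ᵇ_; z≤n; s≤s)
open import Data.Nat.DivMod using (m%n<n; m≡m%n+[m/n]*n)
open import Data.Nat.ListAction using (sum)
open import Data.Nat.Properties hiding (_≟_)
open import Data.Nat.Tactic.RingSolver using (solve-∀)
open import Data.Product as Product using (∃; _×_; _,_; proj₁; proj₂; swap; curry; uncurry)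
open import Data.Product.Properties using (≡-dec; ,-injectiveˡ; ,-injectiveʳ)
open import Data.Sum as Sum using (_⊎_; inj₁; inj₂; [_,_]′)
open import Function using (id; _∘_; case_of_; flip; Bijection)
open import Level using (0ℓ)
open import Relation.Binary using (DecidableEquality; Symmetric; tri<; tri≈; tri>)
import Relation.Binary as Binary
open import Relation.Binary.PropositionalEquality
open import Relation.Nullary using (¬_; Dec; yes; no; does; contradiction)
open import Relation.Nullary.Decidable using (¬?; _×-dec_; _⊎-dec_)
open import Relation.Unary using (Pred; Decidable)

-- Counting by injections

lookup-injective : ∀ {A : Set} {xs : List A} → Unique xs → ∀ {i j} → lookup xs i ≡ lookup xs j → i ≡ j
lookup-injective (_    ∷ _) {fz}   {fz}   eq = refl
lookup-injective (x∉xs ∷ _) {fz}   {fs j} eq = contradiction eq (All.lookup x∉xs (∈-lookup j))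
lookup-injective (x∉xs ∷ _) {fs i} {fz}   eq = contradiction (sym eq) (All.lookup x∉xs (∈-lookup i))
lookup-injective (_    ∷ u) {fs i} {fs j} eq = cong fs (lookup-injective u eq)

-- The common form of all counting arguments below. Totality is asked of members of `xs` only, but
-- injectivity of all related pairs, so `R` has to carry any facts about members that injectivity
-- relies on.
injectiveRelation⇒≤ : ∀ {A B : Set} {xs : List A} {ys : List B} (R : A → B → Set) → Unique xs →
  (∀ {x} → x ∈ xs → ∃ λ y → y ∈ ys × R x y) →
  (∀ {x x′ y} → R x y → R x′ y → x ≡ x′) → length xs ≤ length ys
injectiveRelation⇒≤ {xs = xs} {ys} R unique total injective = injective⇒≤ {f = f} f-injective
  where
  f : Fin (length xs) → Fin (length ys)
  f i = index (proj₁ (proj₂ (total (∈-lookup {xs = xs} i))))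
  R-f : ∀ i → R (lookup xs i) (lookup ys (f i))
  R-f i with total (∈-lookup {xs = xs} i)
  ... | y , y∈ys , r = subst (R _) (lookup-index y∈ys) r
  f-injective : ∀ {i j} → f i ≡ f j → i ≡ j
  f-injective {i} {j} eq = lookup-injective unique
    (injective (R-f i) (subst (R _ ∘ lookup ys) (sym eq) (R-f j)))

module _ {A : Set} {P : Pred A 0ℓ} (P? : Decidable P) where

  length-filter-¬ : ∀ xs → length (filter P? xs) + length (filter (¬? ∘ P?) xs) ≡ length xs
  length-filter-¬ [] = refl
  length-filter-¬ (x ∷ xs) with P? x
  ... | yes _ = cong suc (length-filter-¬ xs)
  ... | no  _ = trans (+-suc _ _) (cong suc (length-filter-¬ xs))

  length-filter-map : ∀ {B : Set} (f : B → A) xs →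
    length (filter P? (map f xs)) ≡ length (filter (P? ∘ f) xs)
  length-filter-map f [] = refl
  length-filter-map f (x ∷ xs) with P? (f x)
  ... | yes _ = cong suc (length-filter-map f xs)
  ... | no  _ = length-filter-map f xs

length-cartesianProduct : ∀ {A B : Set} (xs : List A) (ys : List B) →
  length (cartesianProduct xs ys) ≡ length xs * length ys
length-cartesianProduct [] ys = refl
length-cartesianProduct (x ∷ xs) ys = trans (length-++ (map (x ,_) ys))
  (cong₂ _+_ (length-map (x ,_) ys) (length-cartesianProduct xs ys))

length-filter-cartesianProduct : ∀ {A B : Set} {P : Pred (A × B) 0ℓ} (P? : Decidable P) xs ys →
  length (filter P? (cartesianProduct xs ys)) ≡ sum (map (λ x → length (filter (λ y → P? (x , y)) ys)) xs)
length-filter-cartesianProduct P? [] ys = refl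
length-filter-cartesianProduct P? (x ∷ xs) ys = begin
  length (filter P? (map (x ,_) ys ++ cartesianProduct xs ys))
    ≡⟨ cong length (filter-++ P? (map (x ,_) ys) _) ⟩
  length (filter P? (map (x ,_) ys) ++ filter P? (cartesianProduct xs ys))
    ≡⟨ length-++ (filter P? (map (x ,_) ys)) ⟩
  length (filter P? (map (x ,_) ys)) + length (filter P? (cartesianProduct xs ys))
    ≡⟨ cong₂ _+_ (length-filter-map P? (x ,_) ys) (length-filter-cartesianProduct P? xs ys) ⟩
  _ ∎
  where open ≡-Reasoning

count-filter : ∀ {A : Set} {n} (f : A → Bool) (g : Fin n → A) →
  count (f ∘ g) ≡ length (filter (λ x → f x Bool.≟ true) (tabulate g))
count-filter {n = zero}  f g = refl
count-filter {n = suc n} f g with f (g fz)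
... | true  = cong suc (count-filter f (g ∘ fs))
... | false = count-filter f (g ∘ fs)

-- The summation inside count2 is a local function without a name; abstracting
-- its argument makes unification recover it for the placeholder.
mutual
  count2-sum : ∀ {n} (f : Fin n → Fin n → Bool) → count2 f ≡ sum (tabulate (λ u → count (f u)))
  count2-sum f with (λ u → count (f u))
  ... | g = sumFin-sum f g

  sumFin-sum : ∀ {m} (f : Fin m → Fin m → Bool) (g : Fin m → ℕ) → _ ≡ sum (tabulate g)
  sumFin-sum {zero}  f g = refl
  sumFin-sum {suc m} f g = cong (g fz +_) (sumFin-sum (λ _ _ → true) (g ∘ fs))

-- Listing the pairs turns `numDarts` and `numFaces` into lengths of duplicate-free lists, to which
-- `injectiveRelation⇒≤` applies.
trues : ∀ {n} → (Fin n → Fin n → Bool) → List (Fin n × Fin n)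
trues {n} f = filter (λ (u , v) → f u v Bool.≟ true) (cartesianProduct (List.allFin n) (List.allFin n))

∈-trues⁺ : ∀ {n} (f : Fin n → Fin n → Bool) {u v} → f u v ≡ true → (u , v) ∈ trues f
∈-trues⁺ f fuv = ∈-filter⁺ _ (∈-cartesianProduct⁺ (∈-allFin _) (∈-allFin _)) fuv

∈-trues⁻ : ∀ {n} (f : Fin n → Fin n → Bool) {u v} → (u , v) ∈ trues f → f u v ≡ true
∈-trues⁻ {n} f p = proj₂ (∈-filter⁻ _ {xs = cartesianProduct (List.allFin n) (List.allFin n)} p)

trues-unique : ∀ {n} (f : Fin n → Fin n → Bool) → Unique (trues f)
trues-unique {n} f = Unique.filter⁺ _ (Unique.cartesianProduct⁺ (Unique.allFin⁺ n) (Unique.allFin⁺ n))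

length-trues : ∀ {n} (f : Fin n → Fin n → Bool) → length (trues f) ≡ count2 f
length-trues {n} f = begin
  length (trues f)
    ≡⟨ length-filter-cartesianProduct _ (List.allFin n) (List.allFin n) ⟩
  sum (map (λ u → length (filter (λ v → f u v Bool.≟ true) (List.allFin n))) (List.allFin n))
    ≡⟨ cong sum (map-tabulate {n = n} id _) ⟩
  sum (tabulate (λ u → length (filter (λ v → f u v Bool.≟ true) (List.allFin n))))
    ≡⟨ cong sum (tabulate-cong λ u → sym (count-filter (f u) id)) ⟩
  sum (tabulate (λ u → count (f u)))
    ≡⟨ sym (count2-sum f) ⟩
  count2 f ∎
  where open ≡-Reasoning

bools : List Bool
bools = true ∷ false ∷ []

∈-bools : ∀ s → s ∈ bools
∈-bools true  = here refl
∈-bools false = there (here refl)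

bools-unique : Unique bools
bools-unique = ((λ ()) ∷ []) ∷ [] ∷ []

-- Square-complementary graphs with a 2-colouring

≢-≢⇒≡ : ∀ {a b c : Bool} → a ≢ b → c ≢ b → a ≡ c
≢-≢⇒≡ a≢b c≢b = trans (¬-not a≢b) (sym (¬-not c≢b))

module _ {V : Set} (_~_ : V → V → Set) where

  -- Adjacency in the complement of the square.
  Far : V → V → Set
  Far u v = u ≢ v × ¬ (u ~ v) × (∀ w → ¬ (u ~ w × w ~ v))

module SquareComplementary {V : Set} (_~_ : V → V → Set)
  (_≟_     : DecidableEquality V)
  (_~?_    : Binary.Decidable _~_)
  (common? : ∀ u v → Dec (∃ λ w → u ~ w × w ~ v))
  (symm    : Symmetric _~_)
  (σ σ⁻¹   : V → V)
  (σ∘σ⁻¹   : ∀ v → σ (σ⁻¹ v) ≡ v)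
  (far⇒σ~  : ∀ {u v} → Far _~_ u v → σ u ~ σ v)
  (σ~⇒far  : ∀ {u v} → σ u ~ σ v → Far _~_ u v)
  (χ       : V → Bool)
  (proper  : ∀ {u v} → u ~ v → χ u ≢ χ v)
  (other   : ∀ (v : V) → ∃ λ w → w ≢ v)
  where

  private
    _-_ : V → V → Set
    _-_ = Far _~_

  ψ : V → Bool
  ψ = χ ∘ σ

  far-sym : Symmetric _-_
  far-sym (u≢v , u≁v , none) = u≢v ∘ sym , u≁v ∘ symm , λ w (a , b) → none w (symm b , symm a)

  far⇒ψ≢ : ∀ {u v} → u - v → ψ u ≢ ψ v
  far⇒ψ≢ = proper ∘ far⇒σ~

  -- An isolated vertex v is far from all others; so is σ⁻¹ v from none.
  opaque
    neighbour : ∀ v → ∃ λ w → v ~ w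
    neighbour v with common? v v
    ... | yes (w , v~w , _) = w , v~w
    ... | no ∄w = ⊥-elim (case σ⁻¹ v ≟ v of λ where
      (yes v′≡v) → let w , w≢v = other v in
        isolated (subst (_~ σ w) (trans (cong σ (sym v′≡v)) (σ∘σ⁻¹ v)) (far⇒σ~ (far w w≢v)))
      (no v′≢v) → isolated (symm (subst (σ v ~_) (σ∘σ⁻¹ v) (far⇒σ~ (far (σ⁻¹ v) v′≢v)))))
      where
      isolated : ∀ {w} → ¬ (v ~ w)
      isolated v~w = ∄w (_ , v~w , symm v~w)
      far : ∀ w → w ≢ v → v - w
      far w w≢v = w≢v ∘ sym , isolated , λ _ → isolated ∘ proj₁

  opaque
    farNeighbour : ∀ v → ∃ λ w → v - w
    farNeighbour v = let w , σv~w = neighbour (σ v) in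
      σ⁻¹ w , σ~⇒far (subst (σ v ~_) (sym (σ∘σ⁻¹ w)) σv~w)

  χ≢⇒≢ : ∀ {u v} → χ u ≢ χ v → u ≢ v
  χ≢⇒≢ χ≢ u≡v = χ≢ (cong χ u≡v)

  -- The ends of a path of length two have equal colours, so a bichromatic pair has no common
  -- neighbour.
  χ≢-≁⇒far : ∀ {u v} → χ u ≢ χ v → ¬ (u ~ v) → u - v
  χ≢-≁⇒far χ≢ u≁v = χ≢⇒≢ χ≢ , u≁v , λ w (u~w , w~v) → χ≢ (≢-≢⇒≡ (proper u~w) (proper (symm w~v)))

  χ≢-ψ≡⇒~ : ∀ {u v} → χ u ≢ χ v → ψ u ≡ ψ v → u ~ v
  χ≢-ψ≡⇒~ {u} {v} χ≢ ψ≡ with u ~? v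
  ... | yes u~v = u~v
  ... | no  u≁v = contradiction ψ≡ (far⇒ψ≢ (χ≢-≁⇒far χ≢ u≁v))

  -- Excluding far pairs of equal colour

  module NoFarPair {x x′} (χ≡ : χ x ≡ χ x′) (x-x′ : x - x′) where

    Pure : V → Set
    Pure v = ∃ λ v′ → χ v ≡ χ v′ × v - v′

    pure : ∀ {u v} → χ u ≡ χ v → u - v → Pure u × Pure v
    pure χ≡ u-v = (_ , χ≡ , u-v) , (_ , sym χ≡ , far-sym u-v)

    -- A neighbour `w` of the other `ψ`-colour would share the `ψ`-colour of the far partner `v′`,
    -- so `χ≢-ψ≡⇒~` would make it a common neighbour of `v` and `v′`.
    pure-~ : ∀ {v w} → Pure v → v ~ w → ψ v ≡ ψ w
    pure-~ {v} {w} (v′ , χ≡ , v-v′@(_ , _ , none)) v~w with ψ v Bool.≟ ψ w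
    ... | yes ψ≡ = ψ≡
    ... | no  ψ≢ = contradiction (v~w , w~v′) (none w)
      where
      w~v′ : w ~ v′
      w~v′ = χ≢-ψ≡⇒~ (λ eq → proper v~w (trans χ≡ (sym eq))) (≢-≢⇒≡ (ψ≢ ∘ sym) (far⇒ψ≢ v-v′ ∘ sym))

    pure-far : ∀ {v w} → Pure v → χ v ≢ χ w → ψ v ≢ ψ w → v - w
    pure-far p χ≢ ψ≢ = χ≢-≁⇒far χ≢ (ψ≢ ∘ pure-~ p)

    -- By `pure-~`, a common neighbour would have the `ψ`-colours of both `v` and `w`.
    pure-pure-far : ∀ {v w} → Pure v → Pure w → χ v ≡ χ w → ψ v ≢ ψ w → v - w
    pure-pure-far p q χ≡ ψ≢ = (λ eq → ψ≢ (cong ψ eq)) , (λ v~w → proper v~w χ≡) ,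
      λ y (v~y , y~w) → ψ≢ (trans (pure-~ p v~y) (sym (pure-~ q (symm y~w))))

    -- In the `χ`-class of `x`, the vertices `x` and `x′` have different `ψ`-colours; in the other
    -- class, a neighbour of each inherits its `ψ`-colour by `pure-~`.
    class : ∀ v → ∃ λ z → χ z ≡ χ v × ψ z ≢ ψ v
    class v with χ v Bool.≟ χ x | ψ v Bool.≟ ψ x
    ... | yes χ≡x | no  ψ≢x = x , sym χ≡x , ψ≢x ∘ sym
    ... | yes χ≡x | yes ψ≡x = x′ , trans (sym χ≡) (sym χ≡x) , λ eq → far⇒ψ≢ x-x′ (trans (sym ψ≡x) (sym eq))
    ... | no  χ≢x | no  ψ≢x = let w , x~w = neighbour x in
      w , ≢-≢⇒≡ (proper x~w ∘ sym) χ≢x , λ eq → ψ≢x (trans (sym eq) (sym (pure-~ (proj₁ (pure χ≡ x-x′)) x~w)))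
    ... | no  χ≢x | yes ψ≡x = let w , x′~w = neighbour x′ in
      w , ≢-≢⇒≡ (λ eq → proper x′~w (trans (sym χ≡) (sym eq))) χ≢x ,
      λ eq → far⇒ψ≢ x-x′ (trans (sym ψ≡x) (trans (sym eq) (sym (pure-~ (proj₂ (pure χ≡ x-x′)) x′~w))))

    -- c and c′ play in the far graph the role of x and x′: their far
    -- neighbourhoods partition the opposite class of ψ.
    module _ (c c′ : V) (ψ≡ : ψ c ≡ ψ c′)
             (covered  : ∀ d → ψ d ≢ ψ c → c - d ⊎ c′ - d)
             (disjoint : ∀ {d} → c - d → ¬ (c′ - d)) where

      -- If `c - z`, then `c` is pure. A far neighbour `d` of `c′` has the other `ψ`-colour, so
      -- purity of `c`, together with that of `d` when `d` has the same `χ`-colour, makes `d` far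
      -- from `c` as well.
      same-class : ∀ {z} → χ c ≡ χ c′ → χ z ≡ χ c → ψ z ≢ ψ c → ¬ (c - z)
      same-class {z} χ≡ χz≡ ψz≢ c-z with farNeighbour c′
      ... | d , c′-d with χ c′ Bool.≟ χ d
      ... | no  χ≢ = disjoint
              (pure-far (proj₁ (pure (sym χz≡) c-z)) (λ eq → χ≢ (trans (sym χ≡) eq))
                (λ eq → far⇒ψ≢ c′-d (trans (sym ψ≡) eq)))
              c′-d
      ... | yes χ≡′ = disjoint
              (pure-pure-far (proj₁ (pure (sym χz≡) c-z)) (proj₂ (pure χ≡′ c′-d)) (trans χ≡ χ≡′)
                (λ eq → far⇒ψ≢ c′-d (trans (sym ψ≡) eq)))
              c′-d

      -- One of `x` and `x′`, called `z`, differs from `c` and `c′` in `ψ`. It turns out to be far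
      -- from both, against `disjoint`.
      opposite-class : χ c ≢ χ c′ → χ c ≡ χ x → ⊥
      opposite-class χ≢ χc≡x = disjoint c-z (far-sym z-c′)
        where
        z,pure : ∃ λ z → Pure z × χ z ≡ χ c × ψ z ≢ ψ c
        z,pure with ψ c Bool.≟ ψ x
        ... | no  ψ≢x = x , proj₁ (pure χ≡ x-x′) , sym χc≡x , ψ≢x ∘ sym
        ... | yes ψ≡x = x′ , proj₂ (pure χ≡ x-x′) , trans (sym χ≡) (sym χc≡x) ,
                        λ eq → far⇒ψ≢ x-x′ (trans (sym ψ≡x) (sym eq))
        z = proj₁ z,pure
        z-pure = proj₁ (proj₂ z,pure)
        χz≡ = proj₁ (proj₂ (proj₂ z,pure))
        ψz≢ = proj₂ (proj₂ (proj₂ z,pure))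
        z-c′ : z - c′
        z-c′ = pure-far z-pure (λ eq → χ≢ (trans (sym χz≡) eq)) (λ eq → ψz≢ (trans eq (sym ψ≡)))
        -- If `d` is far from `c′`, the two lie in one `χ`-class, so `d` is pure and by `pure-far`
        -- also far from `c`.
        c-d : ∀ d → χ d ≢ χ c → ψ d ≢ ψ c → c - d
        c-d d χd≢ ψd≢ with covered d ψd≢
        ... | inj₁ c-d  = c-d
        ... | inj₂ c′-d = far-sym (pure-far (proj₂ (pure (≢-≢⇒≡ (χ≢ ∘ sym) χd≢) c′-d)) χd≢ ψd≢)
        -- A common neighbour `w` of `c` and `z` would have the `ψ`-colour of `z` by `pure-~`, and
        -- would then be far from `c` by `c-d`.
        c-z : c - z
        c-z = (λ eq → ψz≢ (cong ψ (sym eq))) , (λ c~z → proper c~z (sym χz≡)) ,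
          λ w (c~w , w~z) → proj₁ (proj₂ (c-d w (proper c~w ∘ sym)
            (λ eq → ψz≢ (trans (pure-~ z-pure (symm w~z)) eq)))) c~w

  -- The neighbourhoods of `x` and `x′` are disjoint because the pair is far, and cover the opposite
  -- `χ`-class because each vertex there agrees in `ψ` with `x` or `x′`. Pulled back along `σ`, this
  -- is the partition by far neighbourhoods required of `c` and `c′`.
  same-colour-not-far : ∀ {x x′} → χ x ≡ χ x′ → ¬ (x - x′)
  same-colour-not-far {x} {x′} χ≡ x-x′@(_ , _ , none) = opposite same
    where
    open NoFarPair χ≡ x-x′
    c = σ⁻¹ x
    c′ = σ⁻¹ x′
    ψ≡ : ψ c ≡ ψ c′
    ψ≡ = trans (cong χ (σ∘σ⁻¹ x)) (trans χ≡ (cong χ (sym (σ∘σ⁻¹ x′))))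
    far-σ⁻¹ : ∀ {d} y → σ d ~ y → (σ⁻¹ y) - d
    far-σ⁻¹ {d} y σd~y = σ~⇒far (symm (subst (σ d ~_) (sym (σ∘σ⁻¹ y)) σd~y))
    σ⁻¹-far : ∀ {d} y → (σ⁻¹ y) - d → y ~ σ d
    σ⁻¹-far {d} y y-d = subst (_~ σ d) (σ∘σ⁻¹ y) (far⇒σ~ y-d)
    covered : ∀ d → ψ d ≢ ψ c → c - d ⊎ c′ - d
    covered d ψd≢ with ψ (σ d) Bool.≟ ψ x
    ... | yes ψ≡x = inj₁ (far-σ⁻¹ x (χ≢-ψ≡⇒~ (λ eq → ψd≢ (trans eq (cong χ (sym (σ∘σ⁻¹ x))))) ψ≡x))
    ... | no  ψ≢x = inj₂ (far-σ⁻¹ x′ (χ≢-ψ≡⇒~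
        (λ eq → ψd≢ (trans eq (trans (sym χ≡) (cong χ (sym (σ∘σ⁻¹ x))))))
        (≢-≢⇒≡ ψ≢x (far⇒ψ≢ x-x′ ∘ sym))))
    disjoint : ∀ {d} → c - d → ¬ (c′ - d)
    disjoint {d} c-d c′-d = none (σ d) (σ⁻¹-far x c-d , symm (σ⁻¹-far x′ c′-d))
    covered′ : ∀ d → ψ d ≢ ψ c′ → c′ - d ⊎ c - d
    covered′ d ψd≢ = Sum.swap (covered d (λ eq → ψd≢ (trans eq ψ≡)))
    same : χ c ≢ χ c′
    same χ≡′ with z , χz≡ , ψz≢ ← class c with covered z ψz≢
    ... | inj₁ c-z  = same-class c c′ ψ≡ covered disjoint χ≡′ χz≡ ψz≢ c-z
    ... | inj₂ c′-z = same-class c′ c (sym ψ≡) covered′ (flip disjoint) (sym χ≡′) (trans χz≡ χ≡′)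
                        (λ eq → ψz≢ (trans eq (sym ψ≡))) c′-z
    opposite : χ c ≢ χ c′ → ⊥
    opposite χ≢ with χ c Bool.≟ χ x
    ... | yes χc≡x = opposite-class c c′ ψ≡ covered disjoint χ≢ χc≡x
    ... | no  χc≢x = opposite-class c′ c (sym ψ≡) covered′ (flip disjoint) (χ≢ ∘ sym)
                       (≢-≢⇒≡ (χ≢ ∘ sym) (χc≢x ∘ sym))

  -- Consequences: common neighbours and degree bounds

  far⇒χ≢ : ∀ {u v} → u - v → χ u ≢ χ v
  far⇒χ≢ u-v χ≡ = same-colour-not-far χ≡ u-v

  opaque
    commonNeighbour : ∀ {u v} → χ u ≡ χ v → ∃ λ w → u ~ w × w ~ v
    commonNeighbour {u} {v} χ≡ with common? u v | u ≟ v
    ... | yes p | _ = p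
    ... | no  _ | yes refl = let w , u~w = neighbour u in w , u~w , symm u~w
    ... | no ∄w | no  u≢v = contradiction (u≢v , (λ u~v → proper u~v χ≡) , curry ∄w) (same-colour-not-far χ≡)

  opaque
    ψ≡⇒commonFarNeighbour : ∀ {u v} → ψ u ≡ ψ v → ∃ λ w → u - w × w - v
    ψ≡⇒commonFarNeighbour {u} {v} ψ≡ = let w , σu~w , w~σv = commonNeighbour ψ≡ in
      σ⁻¹ w , σ~⇒far (subst (σ u ~_) (sym (σ∘σ⁻¹ w)) σu~w) , σ~⇒far (subst (_~ σ v) (sym (σ∘σ⁻¹ w)) w~σv)

  ψ≡⇒χ≡ : ∀ {u v} → ψ u ≡ ψ v → χ u ≡ χ v
  ψ≡⇒χ≡ ψ≡ = let w , u-w , w-v = ψ≡⇒commonFarNeighbour ψ≡ in ≢-≢⇒≡ (far⇒χ≢ u-w) (far⇒χ≢ (far-sym w-v))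

  -- By `ψ≡⇒χ≡`, a neighbour of `u` differs in `ψ` from both `u` and `v`. Hence both colourings
  -- define the same two sides.
  χ≡⇒ψ≡ : ∀ {u v} → χ u ≡ χ v → ψ u ≡ ψ v
  χ≡⇒ψ≡ {u} {v} χ≡ = let w , u~w = neighbour u in
    ≢-≢⇒≡ (proper u~w ∘ ψ≡⇒χ≡) (λ eq → proper u~w (trans χ≡ (ψ≡⇒χ≡ eq)))

  opaque
    commonFarNeighbour : ∀ {u v} → χ u ≡ χ v → ∃ λ w → u - w × w - v
    commonFarNeighbour = ψ≡⇒commonFarNeighbour ∘ χ≡⇒ψ≡

  opaque
    -- Take `w` far from both `p` and `q`, and `r` a common neighbour of `y` and `w`: adjacency to
    -- `w` separates `r` from `p` and `q`.
    neighbour-avoiding : ∀ {y p q} → χ p ≢ χ y → χ q ≢ χ y → ∃ λ r → y ~ r × r ≢ p × r ≢ q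
    neighbour-avoiding χp≢ χq≢
      with w , p-w@(_ , p≁w , _) , _ , w≁q , _ ← commonFarNeighbour (≢-≢⇒≡ χp≢ χq≢)
      with r , y~r , r~w ← commonNeighbour (≢-≢⇒≡ (χp≢ ∘ sym) (far⇒χ≢ (far-sym p-w)))
      = r , y~r , (λ r≡p → p≁w (subst (_~ w) r≡p r~w)) , λ r≡q → w≁q (symm (subst (_~ w) r≡q r~w))

  opaque
    -- The dual argument, with adjacency and farness exchanged.
    farNeighbour-avoiding : ∀ {y p q} → χ p ≢ χ y → χ q ≢ χ y → ∃ λ r → y - r × r ≢ p × r ≢ q
    farNeighbour-avoiding χp≢ χq≢
      with w , p~w , w~q ← commonNeighbour (≢-≢⇒≡ χp≢ χq≢)
      with r , y-r , _ , r≁w , _ ← commonFarNeighbour (≢-≢⇒≡ (χp≢ ∘ sym) (proper (symm p~w)))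
      = r , y-r , (λ r≡p → r≁w (subst (_~ w) (sym r≡p) p~w)) , λ r≡q → r≁w (subst (_~ w) (sym r≡q) (symm w~q))

  opaque
    threeNeighbours : ∀ y → ∃ λ ps → length ps ≡ 3 × Unique ps × All (y ~_) ps
    threeNeighbours y
      with p₁ , y~p₁ ← neighbour y
      with p₂ , y~p₂ , p₂≢p₁ , _ ← neighbour-avoiding (proper y~p₁ ∘ sym) (proper y~p₁ ∘ sym)
      with p₃ , y~p₃ , p₃≢p₁ , p₃≢p₂ ← neighbour-avoiding (proper y~p₁ ∘ sym) (proper y~p₂ ∘ sym)
      = p₁ ∷ p₂ ∷ p₃ ∷ [] , refl ,
        (p₂≢p₁ ∘ sym ∷ p₃≢p₁ ∘ sym ∷ []) ∷ (p₃≢p₂ ∘ sym ∷ []) ∷ [] ∷ [] , y~p₁ ∷ y~p₂ ∷ y~p₃ ∷ []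

  opaque
    threeFarNeighbours : ∀ y → ∃ λ qs → length qs ≡ 3 × Unique qs × All (y -_) qs
    threeFarNeighbours y
      with q₁ , y-q₁ ← farNeighbour y
      with q₂ , y-q₂ , q₂≢q₁ , _ ← farNeighbour-avoiding (far⇒χ≢ y-q₁ ∘ sym) (far⇒χ≢ y-q₁ ∘ sym)
      with q₃ , y-q₃ , q₃≢q₁ , q₃≢q₂ ← farNeighbour-avoiding (far⇒χ≢ y-q₁ ∘ sym) (far⇒χ≢ y-q₂ ∘ sym)
      = q₁ ∷ q₂ ∷ q₃ ∷ [] , refl ,
        (q₂≢q₁ ∘ sym ∷ q₃≢q₁ ∘ sym ∷ []) ∷ (q₃≢q₂ ∘ sym ∷ []) ∷ [] ∷ [] , y-q₁ ∷ y-q₂ ∷ y-q₃ ∷ []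

  module _ {c} {side : List V} (∈-side : ∀ {v} → χ v ≡ c → v ∈ side) {y} (χy≢c : χ y ≢ c) where

    -- Three far neighbours of `y` lie in the same side as `ps` and are disjoint from it.
    neighbours+3≤side : ∀ {ps} → Unique ps → All (y ~_) ps → length ps + 3 ≤ length side
    neighbours+3≤side {ps} ps-unique y~ps with qs , ∣qs∣≡3 , qs-unique , y-qs ← threeFarNeighbours y =
      subst (_≤ length side) (trans (length-++ ps) (cong (length ps +_) ∣qs∣≡3))
        (injectiveRelation⇒≤ _≡_ (Unique.++⁺ ps-unique qs-unique disjoint)
          (λ v∈ → _ , ∈-side (≢-≢⇒≡ (χ≢ (∈-++⁻ ps v∈)) (χy≢c ∘ sym)) , refl)
          (λ v≡w v′≡w → trans v≡w (sym v′≡w)))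
      where
      disjoint : ∀ {v} → ¬ (v ∈ ps × v ∈ qs)
      disjoint (v∈ps , v∈qs) = proj₁ (proj₂ (All.lookup y-qs v∈qs)) (All.lookup y~ps v∈ps)
      χ≢ : ∀ {v} → v ∈ ps ⊎ v ∈ qs → χ v ≢ χ y
      χ≢ (inj₁ v∈ps) eq = proper (All.lookup y~ps v∈ps) (sym eq)
      χ≢ (inj₂ v∈qs) eq = far⇒χ≢ (All.lookup y-qs v∈qs) (sym eq)

    6≤side : 6 ≤ length side
    6≤side with ps , ∣ps∣≡3 , ps-unique , y~ps ← threeNeighbours y =
      subst (λ k → k + 3 ≤ length side) ∣ps∣≡3 (neighbours+3≤side ps-unique y~ps)

-- Faces of a rotation system

module _ {X : Set} (f : X → X) where

  iter-+ : ∀ m k x → iter (m + k) f x ≡ iter m f (iter k f x)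
  iter-+ zero    k x = refl
  iter-+ (suc m) k x = cong f (iter-+ m k x)

  iter-period : ∀ k {p x} → iter p f x ≡ x → iter (k * p) f x ≡ x
  iter-period zero    eq = refl
  iter-period (suc k) {p} eq = trans (iter-+ p (k * p) _) (trans (cong (iter p f) (iter-period k eq)) eq)

  iter-fixed : ∀ k {x} → f x ≡ x → iter k f x ≡ x
  iter-fixed zero    eq = refl
  iter-fixed (suc k) eq = trans (cong f (iter-fixed k eq)) eq

-- Orbits of an injective map on a finite set

module FinitePermutation {X : Set} {N} (code : X → Fin N) (code-injective : ∀ {x y} → code x ≡ code y → x ≡ y)
  (f : X → X) (V : X → Set) (f-V : ∀ {x} → V x → V (f x))
  (f-injective : ∀ {x y} → V x → V y → f x ≡ f y → x ≡ y) where

  iter-V : ∀ k {x} → V x → V (iter k f x)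
  iter-V zero    v = v
  iter-V (suc k) v = f-V (iter-V k v)

  iter-injective : ∀ k {x y} → V x → V y → iter k f x ≡ iter k f y → x ≡ y
  iter-injective zero    v w eq = eq
  iter-injective (suc k) v w eq = iter-injective k v w (f-injective (iter-V k v) (iter-V k w) eq)

  iter-cancel : ∀ i k {x} → V x → iter i f x ≡ iter (k + i) f x → iter k f x ≡ x
  iter-cancel i k {x} v eq = sym (iter-injective i v (iter-V k v)
    (trans eq (trans (cong (λ m → iter m f x) (+-comm k i)) (iter-+ f i k x))))

  period : ∀ {x} → V x → ∃ λ p → suc p ≤ N × iter (suc p) f x ≡ x
  period {x} v with pigeonhole (n<1+n N) (λ i → code (iter (toℕ i) f x))
  ... | i , j , i<j , eq with m≤n⇒∃[o]m+o≡n i<j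
  ...   | p , i+p≡j = p ,
    ≤-trans (≤-trans (s≤s (m≤n+m p (toℕ i))) (≤-reflexive i+p≡j)) (≤-pred (toℕ<n j)) ,
    iter-cancel (toℕ i) (suc p) v (trans (code-injective eq)
      (cong (λ m → iter m f x) (trans (sym i+p≡j) (cong suc (+-comm (toℕ i) p)))))

  -- Orbits are cycles, so `f` can be undone along them, and reduction modulo the period bounds the
  -- exponent. For darts `N` is `n * n`, the range inspected by `orbitMin`.
  reachable : ∀ i j {x y} → V x → V y → iter i f x ≡ iter j f y → ∃ λ k → k < N × iter k f x ≡ y
  reachable i j {x} {y} v w eq with period v
  ... | p , p<N , fix = r , <-≤-trans (m%n<n m (suc p)) p<N , iter-injective j (iter-V r v) w (begin
      iter j f (iter r f x)      ≡⟨ cong (iter j f) reduce ⟨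
      iter j f (iter m f x)      ≡⟨ iter-+ f j m x ⟨
      iter (j + m) f x           ≡⟨ cong (λ k → iter k f x) j+m ⟩
      iter (i + j * suc p) f x   ≡⟨ iter-+ f i (j * suc p) x ⟩
      iter i f (iter (j * suc p) f x) ≡⟨ cong (iter i f) (iter-period f j fix) ⟩
      iter i f x                 ≡⟨ eq ⟩
      iter j f y                 ∎)
    where
    open ≡-Reasoning
    -- Chosen so that `j + m` exceeds `i` by `j` full periods `suc p`.
    m = i + j * p
    r = m % suc p
    reduce : iter m f x ≡ iter r f x
    reduce = trans (cong (λ k → iter k f x) (m≡m%n+[m/n]*n m (suc p)))
      (trans (iter-+ f r (m / suc p * suc p) x) (cong (iter r f) (iter-period f (m / suc p) fix)))
    j+m : j + m ≡ i + j * suc p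
    j+m = begin
      j + (i + j * p) ≡⟨ +-assoc j i (j * p) ⟨
      j + i + j * p   ≡⟨ cong (_+ j * p) (+-comm j i) ⟩
      i + j + j * p   ≡⟨ +-assoc i j (j * p) ⟩
      i + (j + j * p) ≡⟨ cong (i +_) (*-suc j p) ⟨
      i + j * suc p   ∎

allBelow-true : ∀ b (p : ℕ → Bool) → allBelow b p ≡ true → ∀ {k} → k < b → p k ≡ true
allBelow-true (suc b) p all k<1+b with m≤n⇒m<n∨m≡n (≤-pred k<1+b)
... | inj₁ k<b  = allBelow-true b p (∧-conicalˡ _ _ all) k<b
... | inj₂ refl = ∧-conicalʳ (allBelow b p) _ all

lexLeq⇒ : ∀ {n} {a b c d : Fin n} → lexLeq (a , b) (c , d) ≡ true →
  toℕ a < toℕ c ⊎ (a ≡ c × toℕ b ≤ toℕ d)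
lexLeq⇒ {a = a} {b} {c} {d} leq with toℕ a ≡ᵇ toℕ c in eq
... | true  = inj₂ (toℕ-injective (≡ᵇ⇒≡ _ _ (subst T (sym eq) _)) , ≤ᵇ⇒≤ _ _ (subst T (sym leq) _))
... | false = inj₁ (≤∧≢⇒< (≤ᵇ⇒≤ _ _ (subst T (sym (trans (sym (∨-identityʳ _)) leq)) _))
                          (λ a≡c → subst T eq (≡⇒≡ᵇ _ _ a≡c)))

lexLeq-antisym : ∀ {n} {d e : Fin n × Fin n} → lexLeq d e ≡ true → lexLeq e d ≡ true → d ≡ e
lexLeq-antisym {d = a , b} {e = a′ , b′} d≤e e≤d with lexLeq⇒ {a = a} {b} d≤e | lexLeq⇒ {a = a′} {b′} e≤d
... | inj₁ a<a′ | inj₁ a′<a = contradiction a′<a (<⇒≯ a<a′)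
... | inj₁ a<a′ | inj₂ (eq , _) = contradiction (cong toℕ (sym eq)) (<⇒≢ a<a′)
... | inj₂ (eq , _) | inj₁ a′<a = contradiction (cong toℕ (sym eq)) (<⇒≢ a′<a)
... | inj₂ (eq , b≤b′) | inj₂ (_ , b′≤b) = cong₂ _,_ eq (toℕ-injective (≤-antisym b≤b′ b′≤b))

-- Faces of an embedded 2-coloured graph without leaves

module Embedding {n} (G : Graph n) (R : RotationSystem G)
  (χ : Fin n → Bool) (proper : ∀ {u v} → adj G u v ≡ true → χ u ≢ χ v)
  (no-leaf : ∀ {u v} → adj G u v ≡ true → ρ R v u ≢ u) where

  private
    Dart = Fin n × Fin n
    φ = faceStep R

  IsDart : Dart → Set
  IsDart (u , v) = adj G u v ≡ true

  swap-dart : ∀ {d} → IsDart d → IsDart (swap d)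
  swap-dart {u , v} = trans (Graph.sym G v u)

  φ-dart : ∀ {d} → IsDart d → IsDart (φ d)
  φ-dart {u , v} uv = closed R v u (swap-dart uv)

  φ-injective : ∀ {d e} → IsDart d → IsDart e → φ d ≡ φ e → d ≡ e
  φ-injective {u , v} {u′ , v′} uv u′v′ eq with ,-injectiveˡ eq
  ... | refl = cong (_, v) (inj R v u u′ (swap-dart uv) (swap-dart u′v′) (,-injectiveʳ eq))

  open FinitePermutation (uncurry combine) (λ {d} {e} eq → uncurry (cong₂ _,_) (combine-injective _ _ _ _ eq))
    φ IsDart φ-dart φ-injective

  darts : List Dart
  darts = trues (adj G)

  faces : List Dart
  faces = trues (λ u v → adj G u v ∧ orbitMin R (u , v))

  IsFace : Dart → Set
  IsFace d = IsDart d × orbitMin R d ≡ true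

  ∈-faces⁻ : ∀ {d} → d ∈ faces → IsFace d
  ∈-faces⁻ d∈ = let eq = ∈-trues⁻ _ d∈ in ∧-conicalˡ _ _ eq , ∧-conicalʳ _ _ eq

  -- Orbit minima whose iterates meet reach each other, so each is lexicographically below the
  -- other.
  face-unique : ∀ i j {d e} → IsFace d → IsFace e → iter i φ d ≡ iter j φ e → d ≡ e
  face-unique i j (d-dart , d-min) (e-dart , e-min) eq =
    lexLeq-antisym (below d-dart e-dart d-min i j eq) (below e-dart d-dart e-min j i (sym eq))
    where
    below : ∀ {d e} → IsDart d → IsDart e → orbitMin R d ≡ true → ∀ i j → iter i φ d ≡ iter j φ e → lexLeq d e ≡ true
    below {d} d-dart e-dart d-min i j eq with reachable i j d-dart e-dart eq
    ... | k , k<n² , refl = allBelow-true (n * n) (λ k → lexLeq d (iter k φ d)) d-min k<n²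

  χ-φ : ∀ {d} → IsDart d → χ (proj₁ (φ d)) ≡ not (χ (proj₁ d))
  χ-φ uv = ¬-not (proper uv ∘ sym)

  χ-φ² : ∀ {d} → IsDart d → χ (proj₁ (iter 2 φ d)) ≡ χ (proj₁ d)
  χ-φ² d-dart = trans (χ-φ (φ-dart d-dart)) (trans (cong not (χ-φ d-dart)) (not-involutive _))

  φ¹≢ : ∀ {d} → IsDart d → φ d ≢ d
  φ¹≢ d-dart eq = not-¬ refl (trans (cong (χ ∘ proj₁) (sym eq)) (χ-φ d-dart))

  φ²≢ : ∀ {d} → IsDart d → iter 2 φ d ≢ d
  φ²≢ uv eq = no-leaf uv (,-injectiveˡ eq)

  φ³≢ : ∀ {d} → IsDart d → iter 3 φ d ≢ d
  φ³≢ d-dart eq = not-¬ refl (trans (cong (χ ∘ proj₁) (sym eq)) (trans (χ-φ² (φ-dart d-dart)) (χ-φ d-dart)))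

  -- Each face supplies the first four darts of its orbit. They are distinct: colours alternate
  -- along a face, which excludes periods one and three, and period two would contradict `no-leaf`.
  faces*4≤darts : length faces * 4 ≤ length darts
  faces*4≤darts = subst (_≤ length darts) (length-cartesianProduct faces (List.allFin 4))
    (injectiveRelation⇒≤ Token (Unique.cartesianProduct⁺ (trues-unique _) (Unique.allFin⁺ 4)) total injective)
    where
    Token : Dart × Fin 4 → Dart → Set
    Token (d , i) e = IsFace d × iter (toℕ i) φ d ≡ e

    total : ∀ {x} → x ∈ cartesianProduct faces (List.allFin 4) → ∃ λ e → e ∈ darts × Token x e
    total {d , i} x∈ = let d-face = ∈-faces⁻ (proj₁ (∈-cartesianProduct⁻ faces _ x∈)) in
      _ , ∈-trues⁺ _ (iter-V (toℕ i) (proj₁ d-face)) , d-face , refl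

    short : ∀ i k {d} → k < 4 → IsDart d → iter i φ d ≡ iter (k + i) φ d → k ≡ 0
    short i 0 _ _ _ = refl
    short i 1 _ d-dart eq = contradiction (iter-cancel i 1 d-dart eq) (φ¹≢ d-dart)
    short i 2 _ d-dart eq = contradiction (iter-cancel i 2 d-dart eq) (φ²≢ d-dart)
    short i 3 _ d-dart eq = contradiction (iter-cancel i 3 d-dart eq) (φ³≢ d-dart)
    short i (suc (suc (suc (suc _)))) (s≤s (s≤s (s≤s (s≤s ())))) _ _

    ordered : ∀ {i j d} → i ≤ j → j < 4 → IsDart d → iter i φ d ≡ iter j φ d → i ≡ j
    ordered {i} {j} {d} i≤j j<4 d-dart eq = ≤-antisym i≤j (m∸n≡0⇒m≤n (short i (j ∸ i)
      (≤-<-trans (m∸n≤m j i) j<4) d-dart (trans eq (cong (λ k → iter k φ d) (sym (m∸n+n≡m i≤j))))))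

    injective : ∀ {x y e} → Token x e → Token y e → x ≡ y
    injective {d , i} {d′ , j} (d-face , p) (d′-face , q)
      with face-unique (toℕ i) (toℕ j) d-face d′-face (trans p (sym q))
    ... | refl with ≤-total (toℕ i) (toℕ j)
    ...   | inj₁ i≤j = cong (d ,_) (toℕ-injective (ordered i≤j (toℕ<n j) (proj₁ d-face) (trans p (sym q))))
    ...   | inj₂ j≤i = cong (d ,_) (sym (toℕ-injective (ordered j≤i (toℕ<n i) (proj₁ d-face) (trans q (sym p)))))

  -- Counting corners between vertices of one side

  module Coloured (c : Bool) where

    Out : Dart → Set
    Out e = χ (proj₁ e) ≡ c

    -- A dart (y , x) into the side c stands for the corner at y between x and
    -- ρ R y x; the order on Fin n selects one of the two corners of a 4-face.
    Closing : Dart → Set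
    Closing (y , x) = toℕ x < toℕ (ρ R y x) × iter 4 φ (x , y) ≡ (x , y)

    _≟ᵈ_ : (d e : Dart) → Dec (d ≡ e)
    _≟ᵈ_ = ≡-dec Fin._≟_ Fin._≟_

    Used : Dart → Set
    Used e = Out e ⊎ Closing e

    used? : ∀ e → Dec (Used e)
    used? e@(y , x) = (χ y Bool.≟ c) ⊎-dec ((toℕ x <? toℕ (ρ R y x)) ×-dec (iter 4 φ (x , y) ≟ᵈ (x , y)))

    used unused : List Dart
    used   = filter used? darts
    unused = filter (¬? ∘ used?) darts

    -- Colours alternate along a face, so one of `d` and `φ d` leaves side `c`.
    start : Dart → Dart
    start d = if does (χ (proj₁ d) Bool.≟ c) then d else φ d

    start-iter : ∀ {d} → IsDart d → Out (start d) × ∃ λ k → iter k φ d ≡ start d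
    start-iter {d} d-dart with χ (proj₁ d) Bool.≟ c
    ... | yes out = out , 0 , refl
    ... | no ¬out = trans (χ-φ d-dart) (sym (¬-not (¬out ∘ sym))) , 1 , refl

    ¬Out-swap : ∀ {d} → IsDart d → Out d → ¬ Out (swap d)
    ¬Out-swap d-dart o o′ = proper d-dart (trans o (sym o′))

    -- Faces have even length. One of length at least six has three darts leaving side `c`; a 4-face
    -- has two, and its closing corner serves as the third.
    faces*3≤used : length faces * 3 ≤ length used
    faces*3≤used = subst (_≤ length used) (length-cartesianProduct faces (List.allFin 3))
      (injectiveRelation⇒≤ (λ (d , i) e → IsFace d × IsDart e × Token d i e)
        (Unique.cartesianProduct⁺ (trues-unique _) (Unique.allFin⁺ 3)) total injective)
      where
      -- The third token of a 4-face is one of its two outgoing darts, reversed.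
      Token : Dart → Fin 3 → Dart → Set
      Token d fz e = e ≡ start d
      Token d (fs fz) e = e ≡ iter 2 φ (start d)
      Token d (fs (fs fz)) e = (e ≡ iter 4 φ (start d) × e ≢ start d) ⊎
                               (Out (swap e) × ∃ λ k → iter k φ (start d) ≡ swap e)

      start-dart : ∀ {d} → IsDart d → IsDart (start d)
      start-dart d-dart = let _ , k , eq = start-iter d-dart in subst IsDart eq (iter-V k d-dart)

      total : ∀ {x} → x ∈ cartesianProduct faces (List.allFin 3) →
        ∃ λ e → e ∈ used × IsFace (proj₁ x) × IsDart e × Token (proj₁ x) (proj₂ x) e
      total {d , i} x∈ = let e , e-dart , e-used , e-token = token i in
          e , ∈-filter⁺ used? (∈-trues⁺ _ e-dart) e-used , d-face , e-dart , e-token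
        where
        d-face = ∈-faces⁻ (proj₁ (∈-cartesianProduct⁻ faces _ x∈))
        s = start d
        s-dart = start-dart (proj₁ d-face)
        s-out = proj₁ (start-iter (proj₁ d-face))
        x = proj₁ s
        y = proj₂ s
        token : ∀ i → ∃ λ e → IsDart e × Used e × Token d i e
        token fz = s , s-dart , inj₁ s-out , refl
        token (fs fz) = iter 2 φ s , iter-V 2 s-dart , inj₁ (trans (χ-φ² s-dart) s-out) , refl
        token (fs (fs fz)) with iter 4 φ s ≟ᵈ s
        ... | no φ⁴≢ = iter 4 φ s , iter-V 4 s-dart ,
                inj₁ (trans (χ-φ² (iter-V 2 s-dart)) (trans (χ-φ² s-dart) s-out)) , inj₁ (refl , φ⁴≢)
        ... | yes φ⁴≡ with <-cmp (toℕ x) (toℕ (ρ R y x))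
        ...   | tri< x<x′ _ _ = swap s , swap-dart s-dart , inj₂ (x<x′ , φ⁴≡) , inj₂ (s-out , 0 , refl)
        ...   | tri≈ _ x≡x′ _ = contradiction (toℕ-injective (sym x≡x′)) (no-leaf s-dart)
        -- Now the opposite corner is the closing one: by `φ⁴≡`, its rotation leads from `ρ R y x`
        -- back to `x`.
        ...   | tri> _ _ x′<x = swap (iter 2 φ s) , swap-dart (iter-V 2 s-dart) ,
                inj₂ (subst (λ z → toℕ (ρ R y x) < toℕ z) (sym (,-injectiveˡ φ⁴≡)) x′<x , cong (iter 2 φ) φ⁴≡) ,
                inj₂ (trans (χ-φ² s-dart) s-out , 2 , refl)

      -- Exactly one of `e` and `swap e` leaves side `c`, and that one lies on the face of `d`; thus
      -- a token determines its face.
      host : ∀ {d e} i → IsDart d → Token d i e →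
        (Out e × ∃ λ k → iter k φ d ≡ e) ⊎ (Out (swap e) × ∃ λ k → iter k φ d ≡ swap e)
      host {d} {e} i d-dart t with start-iter d-dart
      ... | s-out , k , eq = from i t
        where
        s-dart = start-dart d-dart
        along : ∀ j {e} → iter j φ (start d) ≡ e → ∃ λ k → iter k φ d ≡ e
        along j eq′ = j + k , trans (iter-+ φ j k d) (trans (cong (iter j φ) eq) eq′)
        from : ∀ i → Token d i e → _
        from fz refl = inj₁ (s-out , along 0 refl)
        from (fs fz) refl = inj₁ (trans (χ-φ² s-dart) s-out , along 2 refl)
        from (fs (fs fz)) (inj₁ (refl , _)) =
          inj₁ (trans (χ-φ² (iter-V 2 s-dart)) (trans (χ-φ² s-dart) s-out) , along 4 refl)
        from (fs (fs fz)) (inj₂ (o , j , eq′)) = inj₂ (o , along j eq′)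

      same-face : ∀ {d d′ e} i j → IsFace d → IsFace d′ → IsDart e → Token d i e → Token d′ j e → d ≡ d′
      same-face i j d-face d′-face e-dart t t′ with host i (proj₁ d-face) t | host j (proj₁ d′-face) t′
      ... | inj₁ (_ , k , p) | inj₁ (_ , l , q) = face-unique k l d-face d′-face (trans p (sym q))
      ... | inj₂ (_ , k , p) | inj₂ (_ , l , q) = face-unique k l d-face d′-face (trans p (sym q))
      ... | inj₁ (o , _) | inj₂ (o′ , _) = contradiction o′ (¬Out-swap e-dart o)
      ... | inj₂ (o′ , _) | inj₁ (o , _) = contradiction o′ (¬Out-swap e-dart o)

      same-index : ∀ {d e} i j → IsDart d → IsDart e → Token d i e → Token d j e → i ≡ j
      same-index {d} {e} i j d-dart e-dart = go i j
        where
        s-dart = start-dart d-dart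
        s-out = proj₁ (start-iter d-dart)
        0≢1 : ∀ {e} → e ≡ start d → e ≢ iter 2 φ (start d)
        0≢1 p q = φ²≢ s-dart (trans (sym q) p)
        0≢2 : e ≡ start d → ¬ Token d (fs (fs fz)) e
        0≢2 p (inj₁ (_ , e≢s)) = e≢s p
        0≢2 p (inj₂ (o , _)) = ¬Out-swap e-dart (trans (cong (χ ∘ proj₁) p) s-out) o
        1≢2 : e ≡ iter 2 φ (start d) → ¬ Token d (fs (fs fz)) e
        1≢2 p (inj₁ (q , _)) = φ²≢ (iter-V 2 s-dart) (trans (sym q) p)
        1≢2 p (inj₂ (o , _)) = ¬Out-swap e-dart
          (trans (cong (χ ∘ proj₁) p) (trans (χ-φ² s-dart) s-out)) o
        go : ∀ i j → Token d i e → Token d j e → i ≡ j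
        go fz fz _ _ = refl
        go fz (fs fz) p q = contradiction q (0≢1 p)
        go fz (fs (fs fz)) p q = contradiction q (0≢2 p)
        go (fs fz) fz p q = contradiction p (0≢1 q)
        go (fs fz) (fs fz) _ _ = refl
        go (fs fz) (fs (fs fz)) p q = contradiction q (1≢2 p)
        go (fs (fs fz)) fz p q = contradiction p (0≢2 q)
        go (fs (fs fz)) (fs fz) p q = contradiction p (1≢2 q)
        go (fs (fs fz)) (fs (fs fz)) _ _ = refl

      injective : ∀ {x y e} → IsFace (proj₁ x) × IsDart e × Token (proj₁ x) (proj₂ x) e →
        IsFace (proj₁ y) × IsDart e × Token (proj₁ y) (proj₂ y) e → x ≡ y
      injective {d , i} {d′ , j} (d-face , e-dart , t) (d′-face , _ , t′)
        with same-face i j d-face d′-face e-dart t t′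
      ... | refl = cong (d ,_) (same-index i j (proj₁ d-face) e-dart t t′)

    module _ (side : List (Fin n)) (side-unique : Unique side)
      (∈-side⁻ : ∀ {v} → v ∈ side → χ v ≡ c)
      (common : ∀ {x x′} → χ x ≡ χ x′ → ∃ λ y → IsDart (x , y) × IsDart (y , x′))
      (cubic : ∀ {x x′ y} → χ x ≡ c → IsDart (x , y) → IsDart (y , x′) → x ≢ x′ → ρ R y x ≡ x′ ⊎ ρ R y x′ ≡ x) where

      -- The Boolean is the order in which the pair is read, so that one corner serves both ordered
      -- pairs.
      Corner : Bool → Fin n → Fin n → Dart → Set
      Corner true  x x′ (y , z) = z ≡ x × ρ R y z ≡ x′
      Corner false x x′ (y , z) = z ≡ x′ × ρ R y z ≡ x

      ∈-unused : ∀ {e} → IsDart e → Out (swap e) → ¬ Closing e → e ∈ unused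
      ∈-unused e-dart o ¬closing = ∈-filter⁺ (¬? ∘ used?) (∈-trues⁺ _ e-dart)
        [ (λ o′ → ¬Out-swap e-dart o′ o) , ¬closing ]′

      -- If the corner at y closes a 4-face, the opposite corner does not.
      unused-corner : ∀ {x y} → χ x ≡ c → IsDart (x , y) →
        ∃ λ e → e ∈ unused × ∃ λ s → Corner s x (ρ R y x) e × Corner (not s) (ρ R y x) x e
      unused-corner {x} {y} χx xy with (toℕ x <? toℕ (ρ R y x)) ×-dec (iter 4 φ (x , y) ≟ᵈ (x , y))
      ... | no ¬closing = (y , x) , ∈-unused (swap-dart xy) χx ¬closing , true , (refl , refl) , (refl , refl)
      ... | yes (x<x′ , φ⁴≡) = swap (iter 2 φ (x , y)) ,
          ∈-unused (swap-dart (iter-V 2 xy)) (trans (χ-φ² xy) χx)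
            (λ (x′<x″ , _) → <⇒≯ x<x′ (subst (λ z → toℕ (ρ R y x) < toℕ z) (,-injectiveˡ φ⁴≡) x′<x″)) ,
          false , (refl , ,-injectiveˡ φ⁴≡) , (refl , ,-injectiveˡ φ⁴≡)

      pairs≤unused : length side * length side ≤ 2 * length unused + length side
      pairs≤unused = subst₂ _≤_ (length-cartesianProduct side side)
        (trans (length-++ (map inj₁ (cartesianProduct bools unused))) (cong₂ _+_
          (trans (length-map inj₁ (cartesianProduct bools unused)) (length-cartesianProduct bools unused))
          (length-map inj₂ side)))
        (injectiveRelation⇒≤ Token (Unique.cartesianProduct⁺ side-unique side-unique) total
          (λ {x} {x′} {e} → injective {x} {x′} {e}))
        where
        Token : Fin n × Fin n → (Bool × Dart) ⊎ Fin n → Set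
        Token (x , x′) (inj₁ (s , e)) = Corner s x x′ e
        Token (x , x′) (inj₂ w) = x ≡ w × x′ ≡ w

        total : ∀ {x} → x ∈ cartesianProduct side side →
          ∃ λ e → e ∈ map inj₁ (cartesianProduct bools unused) ++ map inj₂ side × Token x e
        total {x , x′} xx′∈ with ∈-cartesianProduct⁻ side side xx′∈
        ... | x∈ , x′∈ with x Fin.≟ x′
        ...   | yes refl = inj₂ x , ∈-++⁺ʳ (map inj₁ (cartesianProduct bools unused)) (∈-map⁺ inj₂ x∈) , refl , refl
        ...   | no x≢x′ with common (trans (∈-side⁻ x∈) (sym (∈-side⁻ x′∈)))
        ...     | y , xy , yx′ = [ forward , backward ]′ (cubic (∈-side⁻ x∈) xy yx′ x≢x′)
          where
          corner∈ : ∀ s {e} → e ∈ unused → inj₁ (s , e) ∈ map inj₁ (cartesianProduct bools unused) ++ map inj₂ side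
          corner∈ s e∈ = ∈-++⁺ˡ (∈-map⁺ inj₁ (∈-cartesianProduct⁺ (∈-bools s) e∈))
          forward : ρ R y x ≡ x′ → _
          forward refl = let e , e∈ , s , corner , _ = unused-corner (∈-side⁻ x∈) xy in
            inj₁ (s , e) , corner∈ s e∈ , corner
          backward : ρ R y x′ ≡ x → _
          backward refl = let e , e∈ , s , _ , corner = unused-corner (∈-side⁻ x′∈) (swap-dart yx′) in
            inj₁ (not s , e) , corner∈ (not s) e∈ , corner

        injective : ∀ {x x′ e} → Token x e → Token x′ e → x ≡ x′
        injective {e = inj₁ (true  , _ , _)} (refl , refl) (refl , refl) = refl
        injective {e = inj₁ (false , _ , _)} (refl , refl) (refl , refl) = refl
        injective {e = inj₂ _} (refl , refl) (refl , refl) = refl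

-- Bipartite planar square-complementary graphs

anyFin⁺ : ∀ {n} (f : Fin n → Bool) i → f i ≡ true → anyFin f ≡ true
anyFin⁺ f fz     eq rewrite eq = refl
anyFin⁺ f (fs i) eq = trans (cong (f fz ∨_) (anyFin⁺ (f ∘ fs) i eq)) (∨-zeroʳ (f fz))

anyFin⁻ : ∀ {n} (f : Fin n → Bool) → anyFin f ≡ true → ∃ λ i → f i ≡ true
anyFin⁻ {suc n} f eq with f fz in eq₀
... | true  = fz , eq₀
... | false = let i , eqᵢ = anyFin⁻ (f ∘ fs) eq in fs i , eqᵢ

allFin⁺ : ∀ {n} (f : Fin n → Bool) → (∀ i → f i ≡ true) → allFin f ≡ true
allFin⁺ {zero}  f all = refl
allFin⁺ {suc n} f all rewrite all fz = allFin⁺ (f ∘ fs) (all ∘ fs)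

count-none : ∀ {n} (f : Fin n → Bool) → (∀ i → f i ≡ false) → count f ≡ 0
count-none {zero}  f none = refl
count-none {suc n} f none rewrite none fz = count-none (f ∘ fs) (none ∘ fs)

eqF-≢ : ∀ {n} {u v : Fin n} → u ≢ v → eqF u v ≡ false
eqF-≢ {u = u} {v} u≢v with u Fin.≟ v
... | yes u≡v = contradiction u≡v u≢v
... | no  _   = refl

module _ {n} (G : Graph n) where

  infix 4 _~_
  _~_ : Fin n → Fin n → Set
  u ~ v = adj G u v ≡ true

  ~-sym : ∀ {u v} → u ~ v → v ~ u
  ~-sym {u} {v} = trans (Graph.sym G v u)

  ~-irrefl : ∀ {u v} → u ~ v → u ≢ v
  ~-irrefl {u} u~v refl = not-¬ u~v (irrfl G u)

  common? : ∀ u v → Dec (∃ λ w → u ~ w × w ~ v)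
  common? u v = Fin.any? λ w → (adj G u w Bool.≟ true) ×-dec (adj G w v Bool.≟ true)

  far⇒sqAdj : ∀ {u v} → Far _~_ u v → sqAdj G u v ≡ false
  far⇒sqAdj {u} {v} (u≢v , u≁v , none) rewrite eqF-≢ u≢v | ¬-not u≁v = ¬-not λ any →
    let w , eq = anyFin⁻ _ any in none w (∧⁻ eq)
    where
    ∧⁻ : ∀ {a b} → a ∧ b ≡ true → a ≡ true × b ≡ true
    ∧⁻ {true} {true} _ = refl , refl

  sqAdj⇒far : ∀ {u v} → u ≢ v → sqAdj G u v ≡ false → Far _~_ u v
  sqAdj⇒far {u} {v} u≢v eq rewrite eqF-≢ u≢v =
    u≢v , (λ u~v → not-¬ u~v (∨-conicalˡ _ _ eq)) ,
    λ w (u~w , w~v) → not-¬ (anyFin⁺ _ w (cong₂ _∧_ u~w w~v)) (∨-conicalʳ (adj G u v) _ eq)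

euler-contradiction : ∀ {d n f r u b} → d + 4 ≤ 2 * n + 2 * f → 30 ≤ 2 * r → f * 3 ≤ u → u + r ≡ d →
  6 + b ≡ n → 6 * b ≤ d → ⊥
euler-contradiction {d} {n} {f} {r} {u} {b} euler 30≤2r 3f≤u u+r≡d 6+b≡n 6b≤d =
  contradiction bound (<⇒≱ (+-monoʳ-< (2 * d) (+-monoʳ-< d (m≤m+n 37 5))))
  where
  open ≤-Reasoning
  lhs : ∀ d → 2 * d + (d + 42) ≡ 3 * (d + 4) + 30
  lhs = solve-∀
  middle : ∀ n f r → 3 * (2 * n + 2 * f) + 2 * r ≡ 2 * (f * 3) + 2 * r + 6 * n
  middle = solve-∀
  rhs : ∀ b → 6 * (6 + b) ≡ 6 * b + 36
  rhs = solve-∀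
  bound : 2 * d + (d + 42) ≤ 2 * d + (d + 36)
  bound = begin
    2 * d + (d + 42)                  ≡⟨ lhs d ⟩
    3 * (d + 4) + 30                  ≤⟨ +-mono-≤ (*-monoʳ-≤ 3 euler) 30≤2r ⟩
    3 * (2 * n + 2 * f) + 2 * r       ≡⟨ middle n f r ⟩
    2 * (f * 3) + 2 * r + 6 * n       ≤⟨ +-monoˡ-≤ (6 * n) (+-monoˡ-≤ (2 * r) (*-monoʳ-≤ 2 3f≤u)) ⟩
    2 * u + 2 * r + 6 * n             ≡⟨ cong (_+ 6 * n) (*-distribˡ-+ 2 u r) ⟨
    2 * (u + r) + 6 * n               ≡⟨ cong₂ (λ k l → 2 * k + 6 * l) u+r≡d (sym 6+b≡n) ⟩
    2 * d + 6 * (6 + b)               ≡⟨ cong (2 * d +_) (rhs b) ⟩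
    2 * d + (6 * b + 36)              ≤⟨ +-monoʳ-≤ (2 * d) (+-monoˡ-≤ 36 6b≤d) ⟩
    2 * d + (d + 36)                  ∎

module NontrivialSquco {m} (G : Graph (suc (suc m))) (bipartite : Bipartite G) (planar : Planar G) (squco : Squco G) where

  private
    n = suc (suc m)
    V = Fin n
    R = proj₁ planar
    χ = proj₁ bipartite
    σ : V → V
    σ = Bijection.to (proj₁ squco)
    _∼_ = _~_ G

  proper : ∀ {u v} → u ∼ v → χ u ≢ χ v
  proper = proj₂ bipartite _ _

  far⇒σ∼ : ∀ {u v} → Far _∼_ u v → σ u ∼ σ v
  far⇒σ∼ {u} {v} far@(u≢v , _) with adj G (σ u) (σ v) in eq
  ... | true  = refl
  ... | false = contradiction (trans (sym (far⇒sqAdj G far)) (trans (proj₂ squco u v)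
        (cong₂ (λ a b → not a ∧ not b) (eqF-≢ (u≢v ∘ Bijection.injective (proj₁ squco))) eq))) λ ()

  σ∼⇒far : ∀ {u v} → σ u ∼ σ v → Far _∼_ u v
  σ∼⇒far {u} {v} σu∼σv = sqAdj⇒far G (λ u≡v → ~-irrefl G σu∼σv (cong σ u≡v))
    (trans (proj₂ squco u v) (trans (cong (λ b → not (eqF (σ u) (σ v)) ∧ not b) σu∼σv) (∧-zeroʳ _)))

  other : ∀ (v : V) → ∃ λ w → w ≢ v
  other fz     = fs fz , λ ()
  other (fs v) = fz , λ ()

  open SquareComplementary _∼_ Fin._≟_ (λ u v → adj G u v Bool.≟ true) (common? G) (~-sym G) σ
    (λ v → proj₁ (Bijection.strictlySurjective (proj₁ squco) v))
    (λ v → proj₂ (Bijection.strictlySurjective (proj₁ squco) v))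
    far⇒σ∼ σ∼⇒far χ proper other

  -- If `ρ R v` fixed `u`, cyclicity would make `u` the only neighbour of `v`.
  no-leaf : ∀ {u v} → u ∼ v → ρ R v u ≢ u
  no-leaf {u} {v} u∼v ρu≡u =
    let w , v∼w , w≢u , _ = neighbour-avoiding {v} (proper u∼v) (proper u∼v)
        k , eq = cyclic R v u w (~-sym G u∼v) v∼w
    in w≢u (trans (sym eq) (iter-fixed (ρ R v) k ρu≡u))

  open Embedding G R χ proper no-leaf

  record Side (c : Bool) : Set where
    field
      list   : List V
      unique : Unique list
      ∈⁺     : ∀ {v} → χ v ≡ c → v ∈ list
      ∈⁻     : ∀ {v} → v ∈ list → χ v ≡ c

  true? : ∀ v → Dec (χ v ≡ true)
  true? v = χ v Bool.≟ true

  side₁ : Side true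
  side₁ = record
    { list   = filter true? (List.allFin n)
    ; unique = Unique.filter⁺ true? (Unique.allFin⁺ n)
    ; ∈⁺     = ∈-filter⁺ true? (∈-allFin _)
    ; ∈⁻     = proj₂ ∘ ∈-filter⁻ true? {xs = List.allFin n}
    }

  side₂ : Side false
  side₂ = record
    { list   = filter (¬? ∘ true?) (List.allFin n)
    ; unique = Unique.filter⁺ (¬? ∘ true?) (Unique.allFin⁺ n)
    ; ∈⁺     = λ eq → ∈-filter⁺ (¬? ∘ true?) (∈-allFin _) λ eq′ → not-¬ eq′ eq
    ; ∈⁻     = ¬-not ∘ proj₂ ∘ ∈-filter⁻ (¬? ∘ true?) {xs = List.allFin n}
    }

  ∣_∣ : ∀ {c} → Side c → ℕ
  ∣ A ∣ = length (Side.list A)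

  sides : ∣ side₁ ∣ + ∣ side₂ ∣ ≡ n
  sides = trans (length-filter-¬ true? (List.allFin n)) (length-tabulate {n = n} id)

  -- Otherwise `x`, `x′` and their images under `ρ R y` are four distinct neighbours of `y`, and
  -- three far neighbours bring the side to at least seven vertices.
  cubic : ∀ {c} (A : Side c) → ∣ A ∣ ≡ 6 → ∀ {x x′ y} → χ x ≡ c → x ∼ y → y ∼ x′ → x ≢ x′ →
    ρ R y x ≡ x′ ⊎ ρ R y x′ ≡ x
  cubic A ∣A∣≡6 {x} {x′} {y} χx≡c x∼y y∼x′ x≢x′ with ρ R y x Fin.≟ x′ | ρ R y x′ Fin.≟ x
  ... | yes eq | _ = inj₁ eq
  ... | no _ | yes eq = inj₂ eq
  ... | no ρx≢x′ | no ρx′≢x = contradiction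
      (neighbours+3≤side (Side.∈⁺ A) (λ eq → proper x∼y (trans χx≡c (sym eq)))
        ( (x≢x′ ∷ no-leaf x∼y ∘ sym ∷ ρx′≢x ∘ sym ∷ [])
        ∷ (ρx≢x′ ∘ sym ∷ no-leaf (~-sym G y∼x′) ∘ sym ∷ [])
        ∷ (x≢x′ ∘ inj R y x x′ y∼x y∼x′ ∷ [])
        ∷ [] ∷ [])
        (y∼x ∷ y∼x′ ∷ closed R y x y∼x ∷ closed R y x′ y∼x′ ∷ []))
      (<⇒≱ (s≤s (≤-reflexive ∣A∣≡6)))
    where
    y∼x = ~-sym G x∼y

  -- Each of the 2ab ordered bichromatic pairs is a dart of G, or is mapped to one by σ.
  sides≤darts : ∀ {c} (A : Side c) (B : Side (not c)) → ∣ A ∣ * ∣ B ∣ ≤ length darts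
  sides≤darts {c} A B = *-cancelˡ-≤ 2 (subst₂ _≤_
      (trans (length-cartesianProduct bools pairs) (cong (2 *_) (length-cartesianProduct (Side.list A) (Side.list B))))
      (length-cartesianProduct bools darts)
      (injectiveRelation⇒≤ Token
        (Unique.cartesianProduct⁺ bools-unique (Unique.cartesianProduct⁺ (Side.unique A) (Side.unique B)))
        total (λ {x} {x′} {e} → injective {x} {x′} {e})))
    where
    pairs = cartesianProduct (Side.list A) (Side.list B)

    orient : Bool → V × V → V × V
    orient true  = id
    orient false = swap

    -- Here `s` is the direction of the pair, and `t` tells whether the dart is the pair itself or
    -- its image under `σ`. Both sides thus carry a factor two, which cancels.
    Token : Bool × V × V → Bool × V × V → Set
    Token (s , x , y) (t , e) = χ x ≡ c × χ y ≡ not c ×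
      (if t then orient s (x , y) else Product.map σ σ (orient s (x , y))) ≡ e

    total : ∀ {p} → p ∈ cartesianProduct bools pairs → ∃ λ e → e ∈ cartesianProduct bools darts × Token p e
    total {s , x , y} p∈
      with _ , xy∈ ← ∈-cartesianProduct⁻ bools pairs p∈
      with x∈ , y∈ ← ∈-cartesianProduct⁻ (Side.list A) (Side.list B) xy∈
      with adj G (proj₁ (orient s (x , y))) (proj₂ (orient s (x , y))) in eq
    ... | true  = (true , _) , ∈-cartesianProduct⁺ (∈-bools true) (∈-trues⁺ (adj G) eq) , Side.∈⁻ A x∈ , Side.∈⁻ B y∈ , refl
    ... | false = (false , _) , ∈-cartesianProduct⁺ (∈-bools false) (∈-trues⁺ (adj G) (far⇒σ∼ (χ≢-≁⇒far (bichromatic s) (λ eq′ → not-¬ eq′ eq)))) ,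
                  Side.∈⁻ A x∈ , Side.∈⁻ B y∈ , refl
      where
      bichromatic : ∀ s → χ (proj₁ (orient s (x , y))) ≢ χ (proj₂ (orient s (x , y)))
      bichromatic true  eq = not-¬ refl (trans (sym (Side.∈⁻ A x∈)) (trans eq (Side.∈⁻ B y∈)))
      bichromatic false eq = not-¬ refl (trans (sym (Side.∈⁻ A x∈)) (trans (sym eq) (Side.∈⁻ B y∈)))

    orient-injective : ∀ s s′ {x y x′ y′} → χ x ≡ c → χ y ≡ not c → χ x′ ≡ c → χ y′ ≡ not c →
      orient s (x , y) ≡ orient s′ (x′ , y′) → (s , x , y) ≡ (s′ , x′ , y′)
    orient-injective true  true  _ _ _ _ refl = refl
    orient-injective false false _ _ _ _ refl = refl
    orient-injective true  false a _ _ b refl = contradiction (trans (sym a) b) (not-¬ refl)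
    orient-injective false true  _ b a _ refl = contradiction (trans (sym a) b) (not-¬ refl)

    injective : ∀ {p p′ e} → Token p e → Token p′ e → p ≡ p′
    injective {s , _} {s′ , _} {true , _} (a , b , eq) (a′ , b′ , eq′) =
      orient-injective s s′ a b a′ b′ (trans eq (sym eq′))
    injective {s , _} {s′ , _} {false , _} (a , b , eq) (a′ , b′ , eq′) =
      orient-injective s s′ a b a′ b′ (let eq″ = trans eq (sym eq′) in
        cong₂ _,_ (σ-injective (cong proj₁ eq″)) (σ-injective (cong proj₂ eq″)))
      where
      σ-injective : ∀ {u v} → σ u ≡ σ v → u ≡ v
      σ-injective = Bijection.injective (proj₁ squco)

  -- No vertex is isolated, and there is at least one component.
  euler : length darts + 4 ≤ 2 * n + 2 * length faces
  euler = begin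
    length darts + 4                       ≡⟨ +-comm (length darts) 4 ⟩
    4 * 1 + length darts                   ≤⟨ +-monoˡ-≤ (length darts) (*-monoʳ-≤ 4 components≥1) ⟩
    4 * numComponents G + length darts     ≡⟨ cong (4 * numComponents G +_) (length-trues (adj G)) ⟩
    4 * numComponents G + numDarts G       ≡⟨ proj₂ planar ⟨
    2 * n + 2 * numFaces R + 2 * numIsolated G ≡⟨ cong (λ i → 2 * n + 2 * numFaces R + 2 * i) isolated≡0 ⟩
    2 * n + 2 * numFaces R + 0             ≡⟨ +-identityʳ _ ⟩
    2 * n + 2 * numFaces R                 ≡⟨ cong (λ f → 2 * n + 2 * f) (length-trues (λ u v → adj G u v ∧ orbitMin R (u , v))) ⟨
    2 * n + 2 * length faces               ∎
    where
    open ≤-Reasoning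
    isolated≡0 : numIsolated G ≡ 0
    isolated≡0 = count-none _ λ v → let w , v∼w = neighbour v in cong not (anyFin⁺ (adj G v) w v∼w)
    components≥1 : 1 ≤ numComponents G
    -- The vertex `fz` is the least of its component, since `toℕ fz ≤ᵇ toℕ u` computes to `true`.
    components≥1 rewrite allFin⁺ (λ u → not (connected G fz u) ∨ true) (λ u → ∨-zeroʳ _) = s≤s z≤n

  darts+8≤4n : length darts + 8 ≤ 4 * n
  darts+8≤4n = +-cancelˡ-≤ (length darts) _ _ (begin
    length darts + (length darts + 8)  ≡⟨ double (length darts) ⟩
    2 * (length darts + 4)             ≤⟨ *-monoʳ-≤ 2 euler ⟩
    2 * (2 * n + 2 * length faces)     ≡⟨ expand n (length faces) ⟩
    length faces * 4 + 4 * n           ≤⟨ +-monoˡ-≤ (4 * n) faces*4≤darts ⟩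
    length darts + 4 * n               ∎)
    where
    open ≤-Reasoning
    double : ∀ d → d + (d + 8) ≡ 2 * (d + 4)
    double = solve-∀
    expand : ∀ n f → 2 * (2 * n + 2 * f) ≡ f * 4 + 4 * n
    expand = solve-∀

  side≢6 : ∀ {c} (A : Side c) (B : Side (not c)) → ∣ A ∣ + ∣ B ∣ ≡ n → ∣ A ∣ ≢ 6
  side≢6 {c} A B A+B≡n A≡6 = euler-contradiction {length darts} {n} {length faces} {length unused} {length used} {∣ B ∣} euler
    (+-cancelʳ-≤ 6 30 _ (subst (λ a → a * a ≤ 2 * length unused + a) A≡6
      (pairs≤unused (Side.list A) (Side.unique A) (Side.∈⁻ A) commonNeighbour (cubic A A≡6))))
    faces*3≤used
    (length-filter-¬ used? darts)
    (trans (cong (_+ ∣ B ∣) (sym A≡6)) A+B≡n)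
    (subst (λ a → a * ∣ B ∣ ≤ length darts) A≡6 (sides≤darts A B))
    where
    open Coloured c

  absurd : ⊥
  absurd = small (7 ≤? a) (7 ≤? b)
    where
    a = ∣ side₁ ∣
    b = ∣ side₂ ∣

    -- The vertex outside the side that `6≤side` asks for is `fz` or a neighbour of it.
    6≤ : ∀ {c} (A : Side c) → 6 ≤ ∣ A ∣
    6≤ {c} A with χ fz Bool.≟ c
    ... | no  χ≢ = 6≤side (Side.∈⁺ A) χ≢
    ... | yes χ≡ = let w , v∼w = neighbour fz in 6≤side (Side.∈⁺ A) (λ eq → proper v∼w (trans χ≡ (sym eq)))

    -- Equivalently `(a - 4)(b - 4) > 8`, where both factors are at least three.
    product-bound : ∀ {a b} → 7 ≤ a → 7 ≤ b → 4 * (a + b) < a * b + 8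
    product-bound {a} {b} 7≤a 7≤b with i , refl ← m≤n⇒∃[o]m+o≡n 7≤a with j , refl ← m≤n⇒∃[o]m+o≡n 7≤b =
      subst₂ _≤_ refl (expand i j) (m≤m+n _ (3 * i + 3 * j + i * j))
      where
      expand : ∀ i j → suc (4 * (7 + i + (7 + j))) + (3 * i + 3 * j + i * j) ≡ (7 + i) * (7 + j) + 8
      expand = solve-∀

    small : Dec (7 ≤ a) → Dec (7 ≤ b) → ⊥
    small (no a<7) _ = side≢6 side₁ side₂ sides (≤-antisym (≤-pred (≰⇒> a<7)) (6≤ side₁))
    small _ (no b<7) = side≢6 side₂ side₁ (trans (+-comm b a) sides) (≤-antisym (≤-pred (≰⇒> b<7)) (6≤ side₂))
    small (yes 7≤a) (yes 7≤b) = contradiction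
      (≤-trans (+-monoˡ-≤ 8 (sides≤darts side₁ side₂)) (≤-trans darts+8≤4n (≤-reflexive (cong (4 *_) (sym sides)))))
      (<⇒≱ (product-bound 7≤a 7≤b))

theorem5p1 : ∀ (n : ℕ) (G : Graph n) → 1 ≤ n →
    Bipartite G → Planar G → Squco G → n ≡ 1
theorem5p1 (suc zero)    G _ _ _ _ = refl
theorem5p1 (suc (suc m)) G _ bipartite planar squco = ⊥-elim (NontrivialSquco.absurd G bipartite planar squco)
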